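{- Let $q$ be a prime power, $n\ge1$, let $f(x)\in\mathbb{F}_{q^n}[x]$ be a permutation polynomial of $\mathbb{F}_{q^n}$, and let $h_1,\dots,h_n\in\mathbb{F}_q[x]$. For $a_1,\dots,a_n,v_1,\dots,v_n\in\mathbb{F}_{q^n}$, the polynomial $$F(x)=a_1h_1(\mathrm{Tr}(v_1f(x)))+\dots+a_nh_n(\mathrm{Tr}(v_nf(x)))$$ is a permutation polynomial of $\mathbb{F}_{q^n}$ if and only if (i) both $\{a_1,\dots,a_n\}$ and $\{v_1,\dots,v_n\}$ are bases of $\mathbb{F}_{q^n}$ over $\mathbb{F}_q$, and (ii) each $h_i$, $1\le i\le n$, is a permutation polynomial of $\mathbb{F}_q$.
   Context: $\mathrm{Tr}(x)=x+x^q+\dots+x^{q^{n-1}}$ is the trace from $\mathbb{F}_{q^n}$ to $\mathbb{F}_q$. A polynomial is a permutation polynomial of a finite field if the map it induces on that field is bijective. -}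

module Defs where

open import Algebra.Bundles using (CommutativeRing)
open import Algebra.Bundles.Raw using (RawSemiring; RawRing)
open import Algebra.Morphism.Structures using (module RingMorphisms)
import Algebra.Definitions as Definitions
import Algebra.Definitions.RawSemiring as RawSemiringDefs
open import Data.Fin.Base using (Fin; toℕ)
open import Data.List.Base as List using (List; []; _∷_)
open import Data.Nat.Base as ℕ using (ℕ; zero; suc)
open import Data.Nat.Primality using (Prime)
open import Data.Product.Base using (_×_; ∃; ∃₂)
open import Data.Vec.Functional using (Vector)
open import Function.Bundles using (Inverse)
open import Function.Definitions using (Bijective)
open import Level using (Level; _⊔_)
open import Relation.Binary.PropositionalEquality using (_≡_; setoid)
open import Relation.Nullary using (¬_)

private
  variable
    c₁ ℓ₁ c₂ ℓ₂ : Level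

IsPrimePower : ℕ → Set
IsPrimePower q = ∃₂ λ p k → Prime p × 1 ℕ.≤ k × q ≡ p ℕ.^ k

record IsFieldOfOrder (R : CommutativeRing c₁ ℓ₁) (m : ℕ) : Set (c₁ ⊔ ℓ₁) where
  open CommutativeRing R using (Carrier; _≈_; _*_; 0#; 1#)
    renaming (setoid to carrierSetoid)
  open Definitions _≈_ using (Invertible)
  field
    1≉0         : ¬ (1# ≈ 0#)
    invertible  : ∀ x → ¬ (x ≈ 0#) → Invertible 1# _*_ x
    enumeration : Inverse carrierSetoid (setoid (Fin m))

module Polynomial (R : CommutativeRing c₁ ℓ₁) where
  open CommutativeRing R

  -- Coefficients in order of increasing degree. Trailing zeros are allowed, so
  -- the equality of polynomials is _≈ₚ_ rather than that of lists.
  Poly : Set c₁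
  Poly = List Carrier

  coefficient : Poly → ℕ → Carrier
  coefficient []      _       = 0#
  coefficient (a ∷ p) zero    = a
  coefficient (a ∷ p) (suc i) = coefficient p i

  infix 4 _≈ₚ_
  _≈ₚ_ : Poly → Poly → Set ℓ₁
  p ≈ₚ r = ∀ i → coefficient p i ≈ coefficient r i

  const : Carrier → Poly
  const a = a ∷ []

  X : Poly
  X = 0# ∷ 1# ∷ []

  infixl 6 _+ₚ_
  _+ₚ_ : Poly → Poly → Poly
  []      +ₚ r       = r
  (a ∷ p) +ₚ []      = a ∷ p
  (a ∷ p) +ₚ (b ∷ r) = (a + b) ∷ (p +ₚ r)

  infixl 7 _*ₚ_
  _*ₚ_ : Poly → Poly → Poly
  []      *ₚ r = []
  (a ∷ p) *ₚ r = List.map (a *_) r +ₚ (0# ∷ (p *ₚ r))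

  polyRawSemiring : RawSemiring c₁ ℓ₁
  polyRawSemiring = record
    { Carrier = Poly
    ; _≈_     = _≈ₚ_
    ; _+_     = _+ₚ_
    ; _*_     = _*ₚ_
    ; 0#      = []
    ; 1#      = const 1#
    }

  open RawSemiringDefs polyRawSemiring public
    using () renaming (sum to sumₚ; _^_ to _^ₚ_)

  evaluate : Poly → Carrier → Carrier
  evaluate p x = List.foldr (λ a y → a + x * y) 0# p

  infixr 9 _∘ₚ_
  _∘ₚ_ : Poly → Poly → Poly
  p ∘ₚ r = List.foldr (λ a s → const a +ₚ r *ₚ s) [] p

  IsPermutationPolynomial : Poly → Set (c₁ ⊔ ℓ₁)
  IsPermutationPolynomial p = Bijective _≈_ _≈_ (evaluate p)

  -- Tr(x) = x + x^q + … + x^(q^(n-1)) as a polynomial.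
  tracePoly : (q n : ℕ) → Poly
  tracePoly q n = sumₚ {n} (λ j → X ^ₚ (q ℕ.^ toℕ j))

module Extension
  (K : CommutativeRing c₁ ℓ₁) (L : CommutativeRing c₂ ℓ₂)
  (ι : CommutativeRing.Carrier K → CommutativeRing.Carrier L)
  where

  private
    module K = CommutativeRing K
    module L = CommutativeRing L
    module K[x] = Polynomial K
    module L[x] = Polynomial L

    L-rawSemiring : RawSemiring c₂ ℓ₂
    L-rawSemiring = RawRing.rawSemiring L.rawRing

  open RawSemiringDefs L-rawSemiring using (sum)

  IsEmbedding : Set (c₁ ⊔ ℓ₁ ⊔ ℓ₂)
  IsEmbedding = RingMorphisms.IsRingMonomorphism K.rawRing L.rawRing ι

  combination : ∀ {n} → Vector K.Carrier n → Vector L.Carrier n → L.Carrier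
  combination c b = sum (λ i → ι (c i) L.* b i)

  record IsBasis {n : ℕ} (b : Vector L.Carrier n) : Set (c₁ ⊔ ℓ₁ ⊔ c₂ ⊔ ℓ₂) where
    field
      independent : ∀ c → combination c b L.≈ L.0# → ∀ i → c i K.≈ K.0#
      spanning    : ∀ x → ∃ λ c → combination c b L.≈ x

  -- a₁ h₁(Tr(v₁ f)) + … + aₙ hₙ(Tr(vₙ f)), composed formally in L[x].
  traceSum : (q : ℕ) {n : ℕ} (f : L[x].Poly) (h : Vector K[x].Poly n)
             (a v : Vector L.Carrier n) → L[x].Poly
  traceSum q {n} f h a v = L[x].sumₚ λ i →
    L[x].const (a i) L[x].*ₚ
      (List.map ι (h i) L[x].∘ₚ L[x].tracePoly q n L[x].∘ₚ (L[x].const (v i) L[x].*ₚ f))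

{-# OPTIONS --safe #-}
module Submission where

-- F is the composite A ∘ H ∘ T ∘ f of f with the maps
--   T : L → Kⁿ, y ↦ (Tr (v₁ y), …, Tr (vₙ y)),
--   H : Kⁿ → Kⁿ, applying hᵢ to the i-th coordinate,
--   A : Kⁿ → L, c ↦ c₁ a₁ + … + cₙ aₙ.
-- Since L and Kⁿ both have qⁿ elements, F is bijective exactly when A, H and T
-- are. A is bijective iff a is a basis. So is T iff v is a basis: the trace is
-- nonzero because its degree q^(n-1) is less than qⁿ, hence the trace form is
-- nondegenerate.

open import Defs
open import Algebra.Bundles using (CommutativeMonoid; CommutativeRing)
open import Algebra.Morphism.Structures using (module RingMorphisms)
import Algebra.Properties.CommutativeMonoid.Sum as MonoidSum
import Algebra.Properties.CommutativeSemiring.Binomial as Binomial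
import Algebra.Properties.CommutativeSemiring.Exp as Exponentiation
import Algebra.Properties.Ring as RingProperties
import Algebra.Properties.Semiring.Mult as Multiples
import Algebra.Properties.Semiring.Sum as SemiringSum
import Algebra.Solver.Ring.NaturalCoefficients.Default as RingSolver
open import Data.Fin.Base using (Fin; zero; suc; toℕ; fromℕ; inject₁; inject≤; combine; funToFin; finToFun; punchIn)
open import Data.Fin.Permutation using (Permutation; permutation)
open import Data.Fin.Properties using (any?; injective⇒≤; inject≤-injective; toℕ-fromℕ; toℕ-inject₁; toℕ<n; punchInᵢ≢i; funToFin-finToFin; finToFun-funToFin)
  renaming (_≟_ to _≟ᶠ_; suc-injective to suc-injectiveᶠ)
open import Data.List.Base as List using ([]; _∷_)
open import Data.Nat.Base as ℕ using (ℕ; zero; suc; _≤_; _<_; _^_; _∸_; _!; s≤s; z≤n)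
open import Data.Nat.Combinatorics using (_C_; nCk≡n!/k![n-k]!; k![n∸k]!∣n!; nCn≡1)
open import Data.Nat.Divisibility using (_∣_; _∤_; ∣m⇒∣m*n; ∣-refl; >⇒∤; divides; ∣1⇒≡1)
open import Data.Nat.DivMod using (m/n*n≡m)
open import Data.Nat.Primality using (Prime; euclidsLemma; prime⇒nonTrivial; prime⇒nonZero; ¬prime[1])
import Data.Nat.Properties as ℕₚ
open import Data.Product.Base using (_×_; ∃; _,_; proj₁; proj₂)
open import Data.Sum.Base using (inj₁; inj₂)
open import Data.Vec.Functional using (Vector; removeAt; replicate; updateAt)
open import Data.Vec.Functional.Properties using (updateAt-updates; updateAt-minimal)
import Data.Vec.Functional.Relation.Binary.Equality.Setoid as VectorEquality
open import Function.Base using (_∘_)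
open import Function.Bundles using (Inverse; _⇔_; mk⇔)
open import Function.Definitions using (Injective; Surjective; Congruent)
open import Level using (Level)
open import Relation.Binary.Bundles using (Setoid)
open import Relation.Binary.Definitions using (Decidable)
open import Relation.Binary.PropositionalEquality as ≡ using (_≡_; _≢_)
import Relation.Binary.Reasoning.Setoid as SetoidReasoning
open import Relation.Nullary using (¬_; yes; no; contradiction; ¬?)
open import Relation.Nullary.Decidable using (map′; decidable-stable)

-- `K` and `L` are known only through field axioms, enumerations and an embedding, so the
-- characteristic, `x ^ m = x` and the finite-dimensional arguments all come from counting elements.
-- Each `hᵢ` needs an argument in `K`, while `Tr (vᵢ y)` is computed in `L`. It descends because it
-- is fixed by the `q`-th power map, whose fixed points are just the image of `ι`. A bijective
-- composite only makes its outermost factor surjective and its innermost one injective; equal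
-- cardinalities upgrade both to bijections. Under the trace form `T` is the transpose of
-- `c ↦ Σ cᵢ vᵢ`, so the two halves of being a basis change roles: `T` surjective makes `v`
-- independent, and `v` spanning makes `T` injective. Two root counts are needed, for `X^q - X` and
-- for the trace. They are made for functions in Horner form with a formal degree, so no degree is
-- ever read off a coefficient list.

private
  variable
    a b c ℓ c₁ ℓ₁ c₂ ℓ₂ : Level

-- Binomial coefficients divisible by a prime.

prime∤! : ∀ {p} → Prime p → ∀ k → k < p → p ∤ k !
prime∤! pr zero    _   p∣1 = ¬prime[1] (≡.subst Prime (∣1⇒≡1 p∣1) pr)
prime∤! pr (suc k) k<p p∣k! with euclidsLemma (suc k) (k !) pr p∣k!
... | inj₁ p∣1+k = >⇒∤ k<p p∣1+k
... | inj₂ p∣k!′ = prime∤! pr k (ℕₚ.<⇒≤ k<p) p∣k!′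

-- `p` divides `p ! = (p C k) * (k ! * (p ∸ k) !)`, but neither factorial on the right, since both
-- `k` and `p ∸ k` are below `p`.
prime∣C : ∀ {p k} → Prime p → 0 < k → k < p → p ∣ p C k
prime∣C {p@(suc p-1)} {k@(suc k-1)} pr _ k<p
  with euclidsLemma (p C k) (k ! ℕ.* (p ∸ k) !) pr p∣C*k![p-k]!
  where
  k≤p = ℕₚ.<⇒≤ k<p
  instance
    k![p-k]!≢0 : ℕ.NonZero (k ! ℕ.* (p ∸ k) !)
    k![p-k]!≢0 = k ℕₚ.!* (p ∸ k) !≢0
  C*k![p-k]!≡p! : (p C k) ℕ.* (k ! ℕ.* (p ∸ k) !) ≡ p !
  C*k![p-k]!≡p! = ≡.trans (≡.cong (ℕ._* (k ! ℕ.* (p ∸ k) !)) (nCk≡n!/k![n-k]! k≤p)) (m/n*n≡m (k![n∸k]!∣n! k≤p))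
  p∣C*k![p-k]! : p ∣ (p C k) ℕ.* (k ! ℕ.* (p ∸ k) !)
  p∣C*k![p-k]! = ≡.subst (p ∣_) (≡.sym C*k![p-k]!≡p!) (∣m⇒∣m*n (p-1 !) ∣-refl)
... | inj₁ p∣C = p∣C
... | inj₂ p∣k![p-k]! with euclidsLemma (k !) ((p ∸ k) !) pr p∣k![p-k]!
...   | inj₁ p∣k!     = contradiction p∣k! (prime∤! pr k k<p)
...   | inj₂ p∣[p-k]! = contradiction p∣[p-k]! (prime∤! pr (p ∸ k) (s≤s (ℕₚ.m∸n≤m p-1 k-1)))

-- Counting: maps between finite setoids of equal size.

Fin-injective⇒surjective : ∀ {n} (f : Fin n → Fin n) → Injective _≡_ _≡_ f → ∀ y → ∃ λ x → f x ≡ y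
Fin-injective⇒surjective {n} f f-injective y with any? (λ x → f x ≟ᶠ y)
... | yes y∈f = y∈f
... | no  y∉f = contradiction (injective⇒≤ y∷f-injective) ℕₚ.1+n≰n
  where
  -- Pigeonhole: a missed `y` put in front of `f` would inject `Fin (suc n)` into `Fin n`.
  y∷f : Fin (suc n) → Fin n
  y∷f zero    = y
  y∷f (suc i) = f i
  y∷f-injective : Injective _≡_ _≡_ y∷f
  y∷f-injective {zero}  {zero}  _  = ≡.refl
  y∷f-injective {zero}  {suc j} eq = contradiction (j , ≡.sym eq) y∉f
  y∷f-injective {suc i} {zero}  eq = contradiction (i , eq) y∉f
  y∷f-injective {suc i} {suc j} eq = ≡.cong suc (f-injective eq)

module _ {S : Setoid a ℓ₁} {T : Setoid b ℓ₂} {n : ℕ}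
  (S↔n : Inverse S (≡.setoid (Fin n))) (T↔n : Inverse T (≡.setoid (Fin n)))
  {f : Setoid.Carrier S → Setoid.Carrier T}
  (f-cong : Congruent (Setoid._≈_ S) (Setoid._≈_ T) f)
  where

  private
    module S = Setoid S
    module T = Setoid T
    module S↔n = Inverse S↔n
    module T↔n = Inverse T↔n

    to-injectiveˢ : Injective S._≈_ _≡_ S↔n.to
    to-injectiveˢ {x} {y} eq = S.trans (S.sym (S↔n.strictlyInverseʳ x)) (S↔n.inverseʳ eq)

    to-injectiveᵗ : Injective T._≈_ _≡_ T↔n.to
    to-injectiveᵗ {x} {y} eq = T.trans (T.sym (T↔n.strictlyInverseʳ x)) (T↔n.inverseʳ eq)

  equinumerous-injective⇒surjective : Injective S._≈_ T._≈_ f → Surjective S._≈_ T._≈_ f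
  equinumerous-injective⇒surjective f-injective y
    with Fin-injective⇒surjective (T↔n.to ∘ f ∘ S↔n.from)
           (λ {i} {j} eq → ≡.trans (≡.sym (S↔n.strictlyInverseˡ i))
             (S↔n.inverseˡ (f-injective (to-injectiveᵗ eq))))
           (T↔n.to y)
  ... | i , eq = S↔n.from i , λ z≈x → T.trans (f-cong z≈x) (to-injectiveᵗ eq)

  -- A section of `f` is injective, hence by counting reaches every `x`, so `f x` determines `x`.
  -- The section need not respect the setoid equality of its argument, so it is only used on the
  -- representatives `T↔n.from i`, through `g`.
  equinumerous-surjective⇒injective : Surjective S._≈_ T._≈_ f → Injective S._≈_ T._≈_ f
  equinumerous-surjective⇒injective f-surjective {x} {x′} fx≈fx′
    = to-injectiveˢ (≡.trans (≡.sym gy≡x) (≡.trans (≡.cong g y≡y′) gy′≡x′))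
    where
    section : T.Carrier → S.Carrier
    section y = proj₁ (f-surjective y)
    f∘section : ∀ y → f (section y) T.≈ y
    f∘section y = proj₂ (f-surjective y) S.refl
    g : Fin n → Fin n
    g = S↔n.to ∘ section ∘ T↔n.from
    preimage : ∀ x → ∃ λ y → g y ≡ S↔n.to x
    preimage x = Fin-injective⇒surjective g
      (λ {i} {j} eq → ≡.trans (≡.sym (T↔n.strictlyInverseˡ i))
        (T↔n.inverseˡ (T.trans (T.sym (f∘section _)) (T.trans (f-cong (to-injectiveˢ eq)) (f∘section _)))))
      (S↔n.to x)
    y y′ : Fin n
    y  = proj₁ (preimage x)
    y′ = proj₁ (preimage x′)
    gy≡x   = proj₂ (preimage x)
    gy′≡x′ = proj₂ (preimage x′)
    from≈f : ∀ {x y} → g y ≡ S↔n.to x → T↔n.from y T.≈ f x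
    from≈f {x} {y} eq = T.trans (T.sym (f∘section (T↔n.from y))) (f-cong (to-injectiveˢ eq))
    y≡y′ : y ≡ y′
    y≡y′ = ≡.trans (≡.sym (T↔n.strictlyInverseˡ y))
      (T↔n.inverseˡ (T.trans (from≈f gy≡x) (T.trans fx≈fx′ (T.sym (from≈f gy′≡x′)))))

funToFin-cong : ∀ {m n} {f g : Fin m → Fin n} → (∀ i → f i ≡ g i) → funToFin f ≡ funToFin g
funToFin-cong {zero}  f≗g = ≡.refl
funToFin-cong {suc m} f≗g = ≡.cong₂ combine (f≗g zero) (funToFin-cong (f≗g ∘ suc))

module _ (S : Setoid a ℓ) where
  open Setoid S
  open VectorEquality S using (≋-setoid)

  vectorEnumeration : ∀ {m} → Inverse S (≡.setoid (Fin m)) → ∀ n → Inverse (≋-setoid n) (≡.setoid (Fin (m ^ n)))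
  vectorEnumeration {m} S↔m n = record
    { to        = λ u → funToFin (to ∘ u)
    ; from      = λ i → from ∘ finToFun i
    ; to-cong   = λ u≋v → funToFin-cong (to-cong ∘ u≋v)
    ; from-cong = λ { ≡.refl i → refl }
    ; inverse   =
        (λ {i} u≋ → ≡.trans (funToFin-cong (inverseˡ ∘ u≋)) (funToFin-finToFin {n} {m} i)) ,
        (λ { {u} ≡.refl i → inverseʳ (finToFun-funToFin (to ∘ u) i) })
    }
    where open Inverse S↔m

module _ (M : CommutativeMonoid c ℓ) where
  open CommutativeMonoid M
  open MonoidSum M
  open SetoidReasoning setoid

  -- Stated for a commutative monoid because it serves both a product (in `fermat`) and a sum
  -- (pairing with a dual vector under the trace).
  sum-single : ∀ {n} (t : Vector Carrier n) j → (∀ i → i ≢ j → t i ≈ ε) → sum t ≈ t j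
  sum-single {suc n} t j others = begin
    sum t                    ≈⟨ sum-remove t ⟩
    t j ∙ sum (removeAt t j) ≈⟨ ∙-congˡ (sum-cong-≋ λ k → others (punchIn j k) (punchInᵢ≢i j k)) ⟩
    t j ∙ sum (replicate n ε) ≈⟨ ∙-congˡ (sum-replicate-zero n) ⟩
    t j ∙ ε                  ≈⟨ identityʳ (t j) ⟩
    t j                      ∎

-- Polynomial evaluation in a commutative ring.

module RingLemmas (R : CommutativeRing c ℓ) where
  open CommutativeRing R hiding (zero)
  open Exponentiation commutativeSemiring using (^-congˡ; ^-congʳ; ^-assocʳ; ^-distrib-*) renaming (_^_ to _^ʳ_) public
  open SemiringSum semiring using (sum; sum-cong-≋; sum-init-last; sum-permute; ∑-distrib-+; *-distribˡ-sum; sum-replicate; sum-replicate-zero) public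
  open Multiples semiring using (×-assocˡ; ×-congʳ; ×-congˡ; ×-comm-*; ×1-homo-*; ×-homo-1) renaming (_×_ to _×ʳ_) public
  open RingProperties ring using (+-cancelˡ; +-cancelʳ; -‿distribˡ-*; -1*x≈-x) public
  open RingSolver commutativeSemiring using (solve; _:+_; _:*_; _:=_) public
  open Polynomial R
  open SetoidReasoning setoid

  evaluate-cong : ∀ p {x y} → x ≈ y → evaluate p x ≈ evaluate p y
  evaluate-cong []      x≈y = refl
  evaluate-cong (a ∷ p) x≈y = +-congˡ (*-cong x≈y (evaluate-cong p x≈y))

  evaluate-const : ∀ a x → evaluate (const a) x ≈ a
  evaluate-const a x = trans (+-congˡ (zeroʳ x)) (+-identityʳ a)

  evaluate-X : ∀ x → evaluate X x ≈ x
  evaluate-X x = trans (+-identityˡ _) (trans (*-congˡ (evaluate-const 1# x)) (*-identityʳ x))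

  evaluate-+ₚ : ∀ p r x → evaluate (p +ₚ r) x ≈ evaluate p x + evaluate r x
  evaluate-+ₚ []      r       x = sym (+-identityˡ _)
  evaluate-+ₚ (a ∷ p) []      x = sym (+-identityʳ _)
  evaluate-+ₚ (a ∷ p) (b ∷ r) x = begin
    (a + b) + x * evaluate (p +ₚ r) x               ≈⟨ +-congˡ (*-congˡ (evaluate-+ₚ p r x)) ⟩
    (a + b) + x * (evaluate p x + evaluate r x)
      ≈⟨ solve 5 (λ a b x u v → (a :+ b) :+ x :* (u :+ v) := (a :+ x :* u) :+ (b :+ x :* v)) refl a b x _ _ ⟩
    (a + x * evaluate p x) + (b + x * evaluate r x) ∎

  evaluate-scale : ∀ a r x → evaluate (List.map (a *_) r) x ≈ a * evaluate r x
  evaluate-scale a []      x = sym (zeroʳ a)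
  evaluate-scale a (b ∷ r) x = trans (+-congˡ (*-congˡ (evaluate-scale a r x)))
    (solve 4 (λ a b x u → a :* b :+ x :* (a :* u) := a :* (b :+ x :* u)) refl a b x _)

  evaluate-*ₚ : ∀ p r x → evaluate (p *ₚ r) x ≈ evaluate p x * evaluate r x
  evaluate-*ₚ []      r x = sym (zeroˡ _)
  evaluate-*ₚ (a ∷ p) r x = begin
    evaluate (List.map (a *_) r +ₚ (0# ∷ (p *ₚ r))) x
      ≈⟨ evaluate-+ₚ (List.map (a *_) r) (0# ∷ (p *ₚ r)) x ⟩
    evaluate (List.map (a *_) r) x + (0# + x * evaluate (p *ₚ r) x)
      ≈⟨ +-cong (evaluate-scale a r x) (trans (+-identityˡ _) (*-congˡ (evaluate-*ₚ p r x))) ⟩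
    a * evaluate r x + x * (evaluate p x * evaluate r x)
      ≈⟨ solve 4 (λ a x u v → a :* v :+ x :* (u :* v) := (a :+ x :* u) :* v) refl a x _ _ ⟩
    (a + x * evaluate p x) * evaluate r x ∎

  evaluate-^ₚ : ∀ p k x → evaluate (p ^ₚ k) x ≈ evaluate p x ^ʳ k
  evaluate-^ₚ p zero    x = evaluate-const 1# x
  evaluate-^ₚ p (suc k) x = trans (evaluate-*ₚ p (p ^ₚ k) x) (*-congˡ (evaluate-^ₚ p k x))

  evaluate-sumₚ : ∀ {n} (ps : Vector Poly n) x → evaluate (sumₚ ps) x ≈ sum λ i → evaluate (ps i) x
  evaluate-sumₚ {zero}  ps x = refl
  evaluate-sumₚ {suc n} ps x = trans (evaluate-+ₚ (ps zero) (sumₚ (ps ∘ suc)) x) (+-congˡ (evaluate-sumₚ (ps ∘ suc) x))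

  evaluate-∘ₚ : ∀ p r x → evaluate (p ∘ₚ r) x ≈ evaluate p (evaluate r x)
  evaluate-∘ₚ []      r x = refl
  evaluate-∘ₚ (a ∷ p) r x = trans (evaluate-+ₚ (const a) (r *ₚ (p ∘ₚ r)) x)
    (+-cong (evaluate-const a x) (trans (evaluate-*ₚ r (p ∘ₚ r) x) (*-congˡ (evaluate-∘ₚ p r x))))

  1^n≈1 : ∀ n → 1# ^ʳ n ≈ 1#
  1^n≈1 zero    = refl
  1^n≈1 (suc n) = trans (*-identityˡ _) (1^n≈1 n)

  0^n≈0 : ∀ {n} → 0 < n → 0# ^ʳ n ≈ 0#
  0^n≈0 (s≤s _) = zeroˡ _

  ×1-homo-^ : ∀ p k → (p ^ k) ×ʳ 1# ≈ (p ×ʳ 1#) ^ʳ k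
  ×1-homo-^ p zero    = ×-homo-1 1#
  ×1-homo-^ p (suc k) = trans (×1-homo-* p (p ^ k)) (*-congˡ (×1-homo-^ p k))

  -- Additivity of the Frobenius map in characteristic `p`.

  module Frobenius {p} (p-prime : Prime p) (p×1≈0 : p ×ʳ 1# ≈ 0#) where

    ∣⇒×≈0 : ∀ {k} → p ∣ k → ∀ x → k ×ʳ x ≈ 0#
    ∣⇒×≈0 (divides j ≡.refl) x = begin
      (j ℕ.* p) ×ʳ x      ≈⟨ ×-assocˡ x j p ⟨
      j ×ʳ (p ×ʳ x)       ≈⟨ ×-congʳ j (×-congʳ p (*-identityʳ x)) ⟨
      j ×ʳ (p ×ʳ (x * 1#)) ≈⟨ ×-congʳ j (×-comm-* p x 1#) ⟨
      j ×ʳ (x * (p ×ʳ 1#)) ≈⟨ ×-congʳ j (trans (*-congˡ p×1≈0) (zeroʳ x)) ⟩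
      j ×ʳ 0#              ≈⟨ sum-replicate j ⟨
      sum (replicate j 0#) ≈⟨ sum-replicate-zero j ⟩
      0#                   ∎

    ^p-homo-+ : ∀ x y → (x + y) ^ʳ p ≈ x ^ʳ p + y ^ʳ p
    ^p-homo-+ x y = go p p-prime ∣⇒×≈0
      where
      -- `p` is a module parameter; abstracting it again allows the match on `suc p-1`, with the
      -- characteristic carried along as `kill`.
      go : ∀ p → Prime p → (∀ {k} → p ∣ k → ∀ x → k ×ʳ x ≈ 0#) → (x + y) ^ʳ p ≈ x ^ʳ p + y ^ʳ p
      go zero pr _ = contradiction ≡.refl (ℕ.≢-nonZero⁻¹ 0 {{prime⇒nonZero pr}})
      go p@(suc p-1) pr kill = begin
        (x + y) ^ʳ p
          ≈⟨ Binomial.theorem commutativeSemiring p x y ⟩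
        term zero + sum (term ∘ suc)
          ≈⟨ +-congˡ (sum-init-last (term ∘ suc)) ⟩
        term zero + (sum (λ i → term (suc (inject₁ i))) + term (fromℕ p))
          ≈⟨ +-cong first (+-cong (trans (sum-cong-≋ middle) (sum-replicate-zero p-1)) last) ⟩
        y ^ʳ p + (0# + x ^ʳ p)
          ≈⟨ +-congˡ (+-identityˡ _) ⟩
        y ^ʳ p + x ^ʳ p
          ≈⟨ +-comm _ _ ⟩
        x ^ʳ p + y ^ʳ p ∎
        where
        termℕ : ℕ → Carrier
        termℕ k = (p C k) ×ʳ (x ^ʳ k * y ^ʳ (p ∸ k))
        term : Fin (suc p) → Carrier
        term = termℕ ∘ toℕ
        first : term zero ≈ y ^ʳ p
        first = trans (×-homo-1 _) (*-identityˡ _)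
        last : term (fromℕ p) ≈ x ^ʳ p
        last = begin
          termℕ (toℕ (fromℕ p))              ≡⟨ ≡.cong termℕ (toℕ-fromℕ p) ⟩
          (p C p) ×ʳ (x ^ʳ p * y ^ʳ (p ∸ p)) ≈⟨ ×-congˡ (nCn≡1 p) ⟩
          1 ×ʳ (x ^ʳ p * y ^ʳ (p ∸ p))       ≈⟨ ×-homo-1 _ ⟩
          x ^ʳ p * y ^ʳ (p ∸ p)              ≈⟨ *-congˡ (^-congʳ y (ℕₚ.n∸n≡0 p)) ⟩
          x ^ʳ p * 1#                        ≈⟨ *-identityʳ _ ⟩
          x ^ʳ p                             ∎
        middle : ∀ i → term (suc (inject₁ i)) ≈ 0#
        middle i = kill (prime∣C pr (s≤s z≤n) (s≤s (≡.subst (_< p-1) (≡.sym (toℕ-inject₁ i)) (toℕ<n i)))) _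

    ^p^k-homo-+ : ∀ k x y → (x + y) ^ʳ (p ^ k) ≈ x ^ʳ (p ^ k) + y ^ʳ (p ^ k)
    ^p^k-homo-+ zero    x y = trans (*-identityʳ _) (sym (+-cong (*-identityʳ x) (*-identityʳ y)))
    ^p^k-homo-+ (suc k) x y = begin
      (x + y) ^ʳ (p ^ suc k)                ≈⟨ ^-assocʳ (x + y) p (p ^ k) ⟨
      ((x + y) ^ʳ p) ^ʳ (p ^ k)             ≈⟨ ^-congˡ (p ^ k) (^p-homo-+ x y) ⟩
      (x ^ʳ p + y ^ʳ p) ^ʳ (p ^ k)          ≈⟨ ^p^k-homo-+ k (x ^ʳ p) (y ^ʳ p) ⟩
      (x ^ʳ p) ^ʳ (p ^ k) + (y ^ʳ p) ^ʳ (p ^ k) ≈⟨ +-cong (^-assocʳ x p (p ^ k)) (^-assocʳ y p (p ^ k)) ⟩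
      x ^ʳ (p ^ suc k) + y ^ʳ (p ^ suc k)   ∎

  -- Leading terms and division by a root.

  -- g is the function of a polynomial t xᵈ + (terms of lower degree).
  data LeadingTerm (t : Carrier) : ℕ → (Carrier → Carrier) → Set (c Level.⊔ ℓ) where
    constant : ∀ {g} → (∀ x → g x ≈ t) → LeadingTerm t 0 g
    horner   : ∀ {d g k} a → LeadingTerm t d k → (∀ x → g x ≈ a + x * k x) → LeadingTerm t (suc d) g

  leadingTerm-resp : ∀ {s t d g} → s ≈ t → LeadingTerm s d g → LeadingTerm t d g
  leadingTerm-resp s≈t (constant g≈s)   = constant λ x → trans (g≈s x) s≈t
  leadingTerm-resp s≈t (horner a K g≈) = horner a (leadingTerm-resp s≈t K) g≈

  leadingTerm-resp-≗ : ∀ {t d g k} → (∀ x → k x ≈ g x) → LeadingTerm t d g → LeadingTerm t d k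
  leadingTerm-resp-≗ k≈g (constant g≈s)   = constant λ x → trans (k≈g x) (g≈s x)
  leadingTerm-resp-≗ k≈g (horner a K g≈) = horner a K λ x → trans (k≈g x) (g≈ x)

  leadingTerm-+ : ∀ {s t d g k} → LeadingTerm s d g → LeadingTerm t d k → LeadingTerm (s + t) d (λ x → g x + k x)
  leadingTerm-+ (constant g≈) (constant k≈) = constant λ x → +-cong (g≈ x) (k≈ x)
  leadingTerm-+ (horner a G g≈) (horner b K k≈) = horner (a + b) (leadingTerm-+ G K) λ x →
    trans (+-cong (g≈ x) (k≈ x))
      (solve 5 (λ a b x u v → (a :+ x :* u) :+ (b :+ x :* v) := (a :+ b) :+ x :* (u :+ v)) refl a b x _ _)

  leadingTerm-* : ∀ {t d g} r → LeadingTerm t d g → LeadingTerm (r * t) d (λ x → r * g x)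
  leadingTerm-* r (constant g≈)   = constant λ x → *-congˡ (g≈ x)
  leadingTerm-* r (horner a K g≈) = horner (r * a) (leadingTerm-* r K) λ x →
    trans (*-congˡ (g≈ x)) (solve 4 (λ r a x u → r :* (a :+ x :* u) := r :* a :+ x :* (r :* u)) refl r a x _)

  -- The degree is formal: a zero leading coefficient is allowed, so functions of different degrees
  -- can be padded to a common one and added.
  leadingTerm-raise : ∀ {t d g} → LeadingTerm t d g → LeadingTerm 0# (suc d) g
  leadingTerm-raise {t} (constant g≈) = horner {k = λ _ → 0#} t (constant λ _ → refl)
    λ x → trans (g≈ x) (sym (trans (+-congˡ (zeroʳ x)) (+-identityʳ t)))
  leadingTerm-raise (horner a K g≈) = horner a (leadingTerm-raise K) g≈

  leadingTerm-raise< : ∀ {t d e g} → d < e → LeadingTerm t d g → LeadingTerm 0# e g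
  leadingTerm-raise< (s≤s d≤e) G with ℕₚ.m≤n⇒m<n∨m≡n d≤e
  ... | inj₁ d<e    = leadingTerm-raise (leadingTerm-raise< d<e G)
  ... | inj₂ ≡.refl = leadingTerm-raise G

  leadingTerm-0 : ∀ d → LeadingTerm 0# d (λ _ → 0#)
  leadingTerm-0 zero    = constant λ _ → refl
  leadingTerm-0 (suc d) = leadingTerm-raise (leadingTerm-0 d)

  leadingTerm-sum : ∀ {d n} (g : Fin n → Carrier → Carrier) → (∀ i → LeadingTerm 0# d (g i)) →
    LeadingTerm 0# d (λ x → sum λ i → g i x)
  leadingTerm-sum {d} {zero}  g G = leadingTerm-0 d
  leadingTerm-sum {d} {suc n} g G =
    leadingTerm-resp (+-identityˡ 0#) (leadingTerm-+ (G zero) (leadingTerm-sum (g ∘ suc) (G ∘ suc)))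

  leadingTerm-^ : ∀ d → LeadingTerm 1# d (_^ʳ d)
  leadingTerm-^ zero    = constant λ _ → refl
  leadingTerm-^ (suc d) = horner 0# (leadingTerm-^ d) λ x → sym (+-identityˡ _)

  -- g x - g r = (x - r) k x, with both sides moved so that no subtraction occurs.
  factor : ∀ {t d g} → LeadingTerm t (suc d) g → ∀ r →
    ∃ λ k → LeadingTerm t d k × (∀ x → g x + r * k x ≈ g r + x * k x)
  factor {g = g} (horner {k = k} a K@(constant k≈) g≈) r = k , K , λ x → begin
    g x + r * k x             ≈⟨ +-cong (g≈ x) (*-congˡ (trans (k≈ x) (sym (k≈ r)))) ⟩
    (a + x * k x) + r * k r   ≈⟨ solve 3 (λ a u v → (a :+ u) :+ v := (a :+ v) :+ u) refl a _ _ ⟩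
    (a + r * k r) + x * k x   ≈⟨ +-congʳ (g≈ r) ⟨
    g r + x * k x             ∎
  -- If `k x - k r = (x - r) m x`, then `x k x - r k r = (x - r) (k x + r m x)`. The summand `r m`
  -- has lower degree than `k`, so the quotient keeps the leading coefficient.
  factor {g = g} (horner {k = k} a K@(horner _ _ _) g≈) r with factor K r
  ... | m , M , k+rm≈ = (λ x → k x + r * m x)
    , leadingTerm-resp (+-identityʳ _) (leadingTerm-+ K (leadingTerm-raise (leadingTerm-* r M)))
    , λ x → begin
    g x + r * (k x + r * m x)                 ≈⟨ +-cong (g≈ x) (*-congˡ (k+rm≈ x)) ⟩
    (a + x * k x) + r * (k r + x * m x)
      ≈⟨ solve 6 (λ a x r u v w → (a :+ x :* u) :+ r :* (v :+ x :* w) := (a :+ r :* v) :+ x :* (u :+ r :* w)) refl a x r _ _ _ ⟩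
    (a + r * k r) + x * (k x + r * m x)       ≈⟨ +-congʳ (g≈ r) ⟨
    g r + x * (k x + r * m x)                 ∎

-- Finite fields: counting roots, characteristic, Fermat.

module FiniteField (R : CommutativeRing c ℓ) {m : ℕ} (isField : IsFieldOfOrder R m) where
  open CommutativeRing R hiding (zero)
  open RingLemmas R
  open IsFieldOfOrder isField public
  open SetoidReasoning setoid
  private module ∏ = MonoidSum *-commutativeMonoid

  index : Carrier → Fin m
  index = Inverse.to enumeration

  element : Fin m → Carrier
  element = Inverse.from enumeration

  element-index : ∀ x → element (index x) ≈ x
  element-index = Inverse.strictlyInverseʳ enumeration

  element-injective : ∀ {i j} → element i ≈ element j → i ≡ j
  element-injective {i} eq = ≡.trans (≡.sym (Inverse.strictlyInverseˡ enumeration i)) (Inverse.inverseˡ enumeration eq)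

  infix 4 _≟_
  _≟_ : Decidable _≈_
  x ≟ y = map′ (λ eq → trans (sym (element-index x)) (Inverse.inverseʳ enumeration eq))
    (Inverse.to-cong enumeration) (index x ≟ᶠ index y)

  x≉0∧xy≈xz⇒y≈z : ∀ {x} → ¬ x ≈ 0# → ∀ {y z} → x * y ≈ x * z → y ≈ z
  x≉0∧xy≈xz⇒y≈z {x} x≉0 {y} {z} xy≈xz with invertible x x≉0
  ... | x⁻¹ , x⁻¹x≈1 , _ = begin
    y             ≈⟨ *-identityˡ y ⟨
    1# * y        ≈⟨ *-congʳ x⁻¹x≈1 ⟨
    x⁻¹ * x * y   ≈⟨ *-assoc _ _ _ ⟩
    x⁻¹ * (x * y) ≈⟨ *-congˡ xy≈xz ⟩
    x⁻¹ * (x * z) ≈⟨ *-assoc _ _ _ ⟨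
    x⁻¹ * x * z   ≈⟨ *-congʳ x⁻¹x≈1 ⟩
    1# * z        ≈⟨ *-identityˡ z ⟩
    z             ∎

  x≉0∧xy≈0⇒y≈0 : ∀ {x} → ¬ x ≈ 0# → ∀ {y} → x * y ≈ 0# → y ≈ 0#
  x≉0∧xy≈0⇒y≈0 x≉0 xy≈0 = x≉0∧xy≈xz⇒y≈z x≉0 (trans xy≈0 (sym (zeroʳ _)))

  x≉y⇒x-y≉0 : ∀ {x y} → ¬ x ≈ y → ¬ x - y ≈ 0#
  x≉y⇒x-y≉0 {x} {y} x≉y x-y≈0 = x≉y (+-cancelʳ (- y) x y (trans x-y≈0 (sym (-‿inverseʳ y))))

  x≉y∧xz≈yz⇒z≈0 : ∀ {x y z} → ¬ x ≈ y → x * z ≈ y * z → z ≈ 0#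
  x≉y∧xz≈yz⇒z≈0 {x} {y} {z} x≉y xz≈yz = x≉0∧xy≈0⇒y≈0 (x≉y⇒x-y≉0 x≉y) (begin
    (x - y) * z     ≈⟨ distribʳ z x (- y) ⟩
    x * z + - y * z ≈⟨ +-cong xz≈yz (sym (-‿distribˡ-* y z)) ⟩
    y * z - y * z   ≈⟨ -‿inverseʳ (y * z) ⟩
    0#              ∎)

  x^n≈0⇒x≈0 : ∀ {x} n → x ^ʳ n ≈ 0# → x ≈ 0#
  x^n≈0⇒x≈0 zero    1≈0 = contradiction 1≈0 1≉0
  x^n≈0⇒x≈0 {x} (suc n) xx^n≈0 with x ≟ 0#
  ... | yes x≈0 = x≈0
  ... | no  x≉0 = x^n≈0⇒x≈0 n (x≉0∧xy≈0⇒y≈0 x≉0 xx^n≈0)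

  product≉0 : ∀ {n} (t : Vector Carrier n) → (∀ i → ¬ t i ≈ 0#) → ¬ ∏.sum t ≈ 0#
  product≉0 {zero}  t t≉0 = 1≉0
  product≉0 {suc n} t t≉0 = product≉0 (t ∘ suc) (t≉0 ∘ suc) ∘ x≉0∧xy≈0⇒y≈0 (t≉0 zero)

  -- Divide by the root `ρ zero`: the quotient keeps `t`, loses one degree and, in the absence of
  -- zero divisors, vanishes at the other `d` roots. In degree zero a single root already gives
  -- `t ≈ 0#`.
  roots⇒leading≈0 : ∀ {t d g} → LeadingTerm t d g → (ρ : Fin (suc d) → Carrier) →
    (∀ {i j} → ρ i ≈ ρ j → i ≡ j) → (∀ i → g (ρ i) ≈ 0#) → t ≈ 0#
  roots⇒leading≈0 (constant g≈t) ρ _ gρ≈0 = trans (sym (g≈t (ρ zero))) (gρ≈0 zero)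
  roots⇒leading≈0 {g = g} G@(horner _ _ _) ρ ρ-injective gρ≈0 with factor G (ρ zero)
  ... | k , K , factored = roots⇒leading≈0 K (ρ ∘ suc) (suc-injectiveᶠ ∘ ρ-injective) λ i →
    x≉y∧xz≈yz⇒z≈0 (λ eq → contradiction (ρ-injective eq) λ ()) (begin
      ρ zero * k (ρ (suc i))                  ≈⟨ +-identityˡ _ ⟨
      0# + ρ zero * k (ρ (suc i))             ≈⟨ +-congʳ (gρ≈0 (suc i)) ⟨
      g (ρ (suc i)) + ρ zero * k (ρ (suc i))  ≈⟨ factored (ρ (suc i)) ⟩
      g (ρ zero) + ρ (suc i) * k (ρ (suc i))  ≈⟨ +-congʳ (gρ≈0 zero) ⟩
      0# + ρ (suc i) * k (ρ (suc i))          ≈⟨ +-identityˡ _ ⟩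
      ρ (suc i) * k (ρ (suc i))               ∎)

  reindexing : {φ ψ : Carrier → Carrier} → Congruent _≈_ _≈_ φ → Congruent _≈_ _≈_ ψ →
    (∀ x → φ (ψ x) ≈ x) → (∀ x → ψ (φ x) ≈ x) → Permutation m m
  reindexing {φ} {ψ} φ-cong ψ-cong φψ ψφ = permutation (index ∘ φ ∘ element) (index ∘ ψ ∘ element)
    (λ i → Inverse.inverseˡ enumeration (trans (φ-cong (element-index _)) (φψ _)))
    (λ i → Inverse.inverseˡ enumeration (trans (ψ-cong (element-index _)) (ψφ _)))

  -- Translation by 1 permutes the summands of the sum of all elements.
  order×1≈0 : m ×ʳ 1# ≈ 0#
  order×1≈0 = sym (+-cancelʳ (sum element) 0# (m ×ʳ 1#) (begin
    0# + sum element                                ≈⟨ +-identityˡ _ ⟩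
    sum element                                     ≈⟨ sum-permute element translation ⟩
    sum (λ i → element (index (1# + element i)))    ≈⟨ sum-cong-≋ (λ i → element-index (1# + element i)) ⟩
    sum (λ i → 1# + element i)                      ≈⟨ ∑-distrib-+ (λ _ → 1#) element ⟩
    sum {m} (replicate m 1#) + sum element          ≈⟨ +-congʳ (sum-replicate m) ⟩
    m ×ʳ 1# + sum element                           ∎))
    where
    translation : Permutation m m
    translation = reindexing {λ x → 1# + x} {λ x → - 1# + x} +-congˡ +-congˡ
      (λ x → trans (sym (+-assoc _ _ _)) (trans (+-congʳ (-‿inverseʳ 1#)) (+-identityˡ x)))
      (λ x → trans (sym (+-assoc _ _ _)) (trans (+-congʳ (-‿inverseˡ 1#)) (+-identityˡ x)))

  order>0 : 0 < m
  order>0 = ℕₚ.≤-<-trans z≤n (toℕ<n (index 0#))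

  ifZero_then_else_ : Carrier → Carrier → Carrier → Carrier
  ifZero y then u else v with y ≟ 0#
  ... | yes _ = u
  ... | no  _ = v

  ifZero-yes : ∀ {y u v} → y ≈ 0# → ifZero y then u else v ≈ u
  ifZero-yes {y} y≈0 with y ≟ 0#
  ... | yes _   = refl
  ... | no  y≉0 = contradiction y≈0 y≉0

  ifZero-no : ∀ {y u v} → ¬ y ≈ 0# → ifZero y then u else v ≈ v
  ifZero-no {y} y≉0 with y ≟ 0#
  ... | yes y≈0 = contradiction y≈0 y≉0
  ... | no  _   = refl

  -- Multiplication by x permutes the nonzero elements, which gives
  -- ∏ (y ≠ 0) x = 1. The element 0 contributes a factor 1 there, and
  -- supplying its missing factor x gives x ^ m.
  fermat : ∀ x → x ^ʳ m ≈ x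
  fermat x with x ≟ 0#
  ... | yes x≈0 = trans (^-congˡ m x≈0) (trans (0^n≈0 order>0) (sym x≈0))
  ... | no  x≉0 with invertible x x≉0
  ...   | x⁻¹ , x⁻¹x≈1 , xx⁻¹≈1 = begin
    x ^ʳ m                                  ≈⟨ ∏.sum-replicate m ⟨
    ∏.sum {m} (λ _ → x)                     ≈⟨ ∏.sum-cong-≋ split ⟨
    ∏.sum (λ i → atZero i * offZero i)      ≈⟨ ∏.∑-distrib-+ atZero offZero ⟩
    ∏.sum atZero * ∏.sum offZero            ≈⟨ *-cong ∏atZero≈x ∏offZero≈1 ⟩
    x * 1#                                  ≈⟨ *-identityʳ x ⟩
    x                                       ∎
    where
    atZero offZero unit : Fin m → Carrier
    atZero  i = ifZero element i then x else 1#
    offZero i = ifZero element i then 1# else x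
    unit    i = ifZero element i then 1# else element i

    split : ∀ i → atZero i * offZero i ≈ x
    split i with element i ≟ 0#
    ... | yes _ = *-identityʳ x
    ... | no  _ = *-identityˡ x

    ∏atZero≈x : ∏.sum atZero ≈ x
    ∏atZero≈x = trans
      (sum-single *-commutativeMonoid atZero (index 0#) λ i i≢ →
        ifZero-no λ eᵢ≈0 → i≢ (element-injective (trans eᵢ≈0 (sym (element-index 0#)))))
      (ifZero-yes (element-index 0#))

    unit≉0 : ∀ i → ¬ unit i ≈ 0#
    unit≉0 i with element i ≟ 0#
    ... | yes _   = 1≉0
    ... | no  y≉0 = y≉0

    dilation : Permutation m m
    dilation = reindexing {x *_} {x⁻¹ *_} *-congˡ *-congˡ
      (λ y → trans (sym (*-assoc _ _ _)) (trans (*-congʳ xx⁻¹≈1) (*-identityˡ y)))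
      (λ y → trans (sym (*-assoc _ _ _)) (trans (*-congʳ x⁻¹x≈1) (*-identityˡ y)))

    dilated : ∀ i → unit (index (x * element i)) ≈ offZero i * unit i
    dilated i with element i ≟ 0#
    ... | yes eᵢ≈0 = trans
      (ifZero-yes (trans (element-index _) (trans (*-congˡ eᵢ≈0) (zeroʳ x)))) (sym (*-identityʳ 1#))
    ... | no  eᵢ≉0 = trans
      (ifZero-no (λ eq → eᵢ≉0 (x≉0∧xy≈0⇒y≈0 x≉0 (trans (sym (element-index _)) eq)))) (element-index _)

    ∏offZero≈1 : ∏.sum offZero ≈ 1#
    ∏offZero≈1 = x≉0∧xy≈xz⇒y≈z (product≉0 unit unit≉0) (begin
      ∏.sum unit * ∏.sum offZero                   ≈⟨ *-comm _ _ ⟩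
      ∏.sum offZero * ∏.sum unit                   ≈⟨ ∏.∑-distrib-+ offZero unit ⟨
      ∏.sum (λ i → offZero i * unit i)             ≈⟨ ∏.sum-cong-≋ dilated ⟨
      ∏.sum (λ i → unit (index (x * element i)))   ≈⟨ ∏.sum-permute unit dilation ⟨
      ∏.sum unit                                   ≈⟨ *-identityʳ _ ⟨
      ∏.sum unit * 1#                              ∎)

  -- `(p × 1) ^ k = p ^ k × 1 = m × 1 = 0`, and a field has no nonzero nilpotents.
  characteristic : ∀ {p k} → m ≡ p ^ k → p ×ʳ 1# ≈ 0#
  characteristic {p} {k} ≡.refl = x^n≈0⇒x≈0 k (trans (sym (×1-homo-^ p k)) order×1≈0)

-- The trace from `L` to `K`.

module Trace {c₁ ℓ₁ c₂ ℓ₂ : Level} {q n : ℕ} (q-primePower : IsPrimePower q) (1≤n : 1 ≤ n)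
  (K : CommutativeRing c₁ ℓ₁) (L : CommutativeRing c₂ ℓ₂)
  (K-isField : IsFieldOfOrder K q) (L-isField : IsFieldOfOrder L (q ^ n))
  (ι : CommutativeRing.Carrier K → CommutativeRing.Carrier L)
  (ι-isEmbedding : Extension.IsEmbedding K L ι)
  where

  private
    module K where
      open CommutativeRing K public
      open RingLemmas K public
      open FiniteField K K-isField public
      open Polynomial K public
    module V = VectorEquality K.setoid

  open CommutativeRing L hiding (zero)
  open RingLemmas L
  open FiniteField L L-isField
  open Polynomial L
  open Extension K L ι
  open RingMorphisms K.rawRing rawRing using (module IsRingMonomorphism)
  open IsRingMonomorphism ι-isEmbedding
    using (+-homo; *-homo; 0#-homo; 1#-homo; injective)
    renaming (⟦⟧-cong to ι-cong)

  private
    p k : ℕ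
    p = proj₁ q-primePower
    k = proj₁ (proj₂ q-primePower)

    p-prime : Prime p
    p-prime = proj₁ (proj₂ (proj₂ q-primePower))

    1≤k : 1 ≤ k
    1≤k = proj₁ (proj₂ (proj₂ (proj₂ q-primePower)))

    q≡p^k : q ≡ p ^ k
    q≡p^k = proj₂ (proj₂ (proj₂ (proj₂ q-primePower)))

    q^j≡p^[k*j] : ∀ j → q ^ j ≡ p ^ (k ℕ.* j)
    q^j≡p^[k*j] j = ≡.trans (≡.cong (_^ j) q≡p^k) (ℕₚ.^-*-assoc p k j)

  1<q : 1 < q
  1<q = begin-strict
    1     <⟨ ℕ.nonTrivial⇒n>1 p {{prime⇒nonTrivial p-prime}} ⟩
    p     ≡⟨ ℕₚ.^-identityʳ p ⟨
    p ^ 1 ≤⟨ ℕₚ.^-monoʳ-≤ p {{prime⇒nonZero p-prime}} 1≤k ⟩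
    p ^ k ≡⟨ q≡p^k ⟨
    q     ∎
    where open ℕₚ.≤-Reasoning

  -- The order `q ^ n` of `L` is a power of `p`, so `L` has characteristic `p`; the exponent `q ^ j`
  -- is one too, so the map is an iterate of Frobenius.
  ^q^j-homo-+ : ∀ j x y → (x + y) ^ʳ (q ^ j) ≈ x ^ʳ (q ^ j) + y ^ʳ (q ^ j)
  ^q^j-homo-+ j x y = ≡.subst (λ m → (x + y) ^ʳ m ≈ x ^ʳ m + y ^ʳ m) (≡.sym (q^j≡p^[k*j] j))
    (Frobenius.^p^k-homo-+ p-prime (characteristic {p} {k ℕ.* n} (q^j≡p^[k*j] n)) (k ℕ.* j) x y)

  open SetoidReasoning setoid

  ^q-homo-+ : ∀ x y → (x + y) ^ʳ q ≈ x ^ʳ q + y ^ʳ q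
  ^q-homo-+ x y = ≡.subst (λ m → (x + y) ^ʳ m ≈ x ^ʳ m + y ^ʳ m) (ℕₚ.^-identityʳ q) (^q^j-homo-+ 1 x y)

  ^q-homo-sum : ∀ {m} (t : Vector Carrier m) → sum t ^ʳ q ≈ sum λ i → t i ^ʳ q
  ^q-homo-sum {zero}  t = 0^n≈0 (ℕₚ.<⇒≤ 1<q)
  ^q-homo-sum {suc m} t = trans (^q-homo-+ (t zero) (sum (t ∘ suc))) (+-congˡ (^q-homo-sum (t ∘ suc)))

  ι-^ : ∀ κ m → ι (κ K.^ʳ m) ≈ ι κ ^ʳ m
  ι-^ κ zero    = 1#-homo
  ι-^ κ (suc m) = trans (*-homo κ (κ K.^ʳ m)) (*-congˡ (ι-^ κ m))

  ι-^q^j : ∀ κ j → ι κ ^ʳ (q ^ j) ≈ ι κ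
  ι-^q^j κ zero    = *-identityʳ (ι κ)
  ι-^q^j κ (suc j) = begin
    ι κ ^ʳ (q ^ suc j)    ≈⟨ ^-assocʳ (ι κ) q (q ^ j) ⟨
    (ι κ ^ʳ q) ^ʳ (q ^ j) ≈⟨ ^-congˡ (q ^ j) (trans (sym (ι-^ κ q)) (ι-cong (K.fermat κ))) ⟩
    ι κ ^ʳ (q ^ j)        ≈⟨ ι-^q^j κ j ⟩
    ι κ                   ∎

  -- Otherwise x and the q elements of ι K would be q + 1 roots of X^q - X.
  fixed⇒∈K : ∀ x → x ^ʳ q ≈ x → ∃ λ κ → ι κ ≈ x
  fixed⇒∈K x x^q≈x with any? (λ i → ι (K.element i) ≟ x)
  ... | yes (i , eq) = K.element i , eq
  ... | no  x∉K = contradiction (roots⇒leading≈0 X^q-X ρ ρ-injective ρ-roots) 1≉0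
    where
    X^q-X : LeadingTerm 1# q (λ y → y ^ʳ q + - 1# * y ^ʳ 1)
    X^q-X = leadingTerm-resp (+-identityʳ 1#)
      (leadingTerm-+ (leadingTerm-^ q) (leadingTerm-raise< 1<q (leadingTerm-* (- 1#) (leadingTerm-^ 1))))
    ρ : Fin (suc q) → Carrier
    ρ zero    = x
    ρ (suc i) = ι (K.element i)
    ρ-injective : ∀ {i j} → ρ i ≈ ρ j → i ≡ j
    ρ-injective {zero}  {zero}  _  = ≡.refl
    ρ-injective {zero}  {suc j} eq = contradiction (j , sym eq) x∉K
    ρ-injective {suc i} {zero}  eq = contradiction (i , eq) x∉K
    ρ-injective {suc i} {suc j} eq = ≡.cong suc (K.element-injective (injective eq))
    ρ^q≈ρ : ∀ i → ρ i ^ʳ q ≈ ρ i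
    ρ^q≈ρ zero    = x^q≈x
    ρ^q≈ρ (suc i) = trans (sym (ι-^ (K.element i) q)) (ι-cong (K.fermat (K.element i)))
    ρ-roots : ∀ i → ρ i ^ʳ q + - 1# * ρ i ^ʳ 1 ≈ 0#
    ρ-roots i = begin
      ρ i ^ʳ q + - 1# * ρ i ^ʳ 1 ≈⟨ +-cong (ρ^q≈ρ i) (*-congˡ (*-identityʳ (ρ i))) ⟩
      ρ i + - 1# * ρ i           ≈⟨ +-congˡ (-1*x≈-x (ρ i)) ⟩
      ρ i - ρ i                  ≈⟨ -‿inverseʳ (ρ i) ⟩
      0#                         ∎

  Tr : Carrier → Carrier
  Tr x = sum {n} λ j → x ^ʳ (q ^ toℕ j)

  Tr-cong : ∀ {x y} → x ≈ y → Tr x ≈ Tr y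
  Tr-cong x≈y = sum-cong-≋ λ (j : Fin n) → ^-congˡ (q ^ toℕ j) x≈y

  Tr-homo-+ : ∀ x y → Tr (x + y) ≈ Tr x + Tr y
  Tr-homo-+ x y = trans (sum-cong-≋ λ (j : Fin n) → ^q^j-homo-+ (toℕ j) x y)
    (∑-distrib-+ (λ (j : Fin n) → x ^ʳ (q ^ toℕ j)) (λ j → y ^ʳ (q ^ toℕ j)))

  Tr-homo-* : ∀ κ x → Tr (ι κ * x) ≈ ι κ * Tr x
  Tr-homo-* κ x = trans
    (sum-cong-≋ λ (j : Fin n) → trans (^-distrib-* (ι κ) x (q ^ toℕ j)) (*-congʳ (ι-^q^j κ (toℕ j))))
    (sym (*-distribˡ-sum (ι κ) (λ (j : Fin n) → x ^ʳ (q ^ toℕ j))))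

  Tr-0 : Tr 0# ≈ 0#
  Tr-0 = sym (+-cancelˡ (Tr 0#) 0# (Tr 0#)
    (trans (+-identityʳ _) (trans (Tr-cong (sym (+-identityʳ 0#))) (Tr-homo-+ 0# 0#))))

  -- The `q`-th power shifts the conjugates `x ^ (q ^ j)` by one place. The shift is cyclic because
  -- the new last one, `x ^ (q ^ n)`, is `x` by Fermat in `L`.
  Tr-^q : ∀ x → Tr x ^ʳ q ≈ Tr x
  Tr-^q x = begin
    Tr x ^ʳ q                            ≈⟨ ^q-homo-sum (λ (j : Fin n) → x ^ʳ (q ^ toℕ j)) ⟩
    sum {n} (λ j → (x ^ʳ (q ^ toℕ j)) ^ʳ q) ≈⟨ sum-cong-≋ (λ (j : Fin n) → shift (toℕ j)) ⟩
    sum {n} (λ j → u (suc (toℕ j)))      ≈⟨ +-cancelˡ x _ _ telescope ⟩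
    sum {n} (λ j → u (toℕ j))            ∎
    where
    u : ℕ → Carrier
    u j = x ^ʳ (q ^ j)
    shift : ∀ j → u j ^ʳ q ≈ u (suc j)
    shift j = trans (^-assocʳ x (q ^ j) q) (^-congʳ x (ℕₚ.*-comm (q ^ j) q))
    telescope : x + sum {n} (λ j → u (suc (toℕ j))) ≈ x + sum {n} (λ j → u (toℕ j))
    telescope = begin
      x + sum {n} (λ j → u (suc (toℕ j)))                        ≈⟨ +-congʳ (*-identityʳ x) ⟨
      sum {suc n} (λ j → u (toℕ j))                              ≈⟨ sum-init-last {n} (λ j → u (toℕ j)) ⟩
      sum {n} (λ j → u (toℕ (inject₁ j))) + u (toℕ (fromℕ n))
        ≈⟨ +-cong (sum-cong-≋ λ (j : Fin n) → reflexive (≡.cong u (toℕ-inject₁ j)))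
                  (trans (reflexive (≡.cong u (toℕ-fromℕ n))) (fermat x)) ⟩
      sum {n} (λ j → u (toℕ j)) + x                              ≈⟨ +-comm _ _ ⟩
      x + sum {n} (λ j → u (toℕ j))                              ∎

  -- Tr has degree q^(n-1), less than the number of elements of L.
  ∃Tr≉0 : ∃ λ x → ¬ Tr x ≈ 0#
  ∃Tr≉0 with any? (λ i → ¬? (Tr (element i) ≟ 0#))
  ... | yes (i , Tr≉0) = element i , Tr≉0
  ... | no  ∄Tr≉0 = contradiction
    (roots⇒leading≈0 (leading 1≤n) (element ∘ inject≤′)
      (λ eq → inject≤-injective q^[n-1]<q^n q^[n-1]<q^n _ _ (element-injective eq))
      (λ i → decidable-stable (Tr _ ≟ 0#) (λ Tr≉0 → ∄Tr≉0 (inject≤′ i , Tr≉0))))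
    1≉0
    where
    leading : ∀ {n} → 1 ≤ n → LeadingTerm 1# (q ^ (n ∸ 1)) (λ x → sum {n} λ j → x ^ʳ (q ^ toℕ j))
    leading {suc n} _ = leadingTerm-resp-≗
      (λ x → sum-init-last {n} (λ j → x ^ʳ (q ^ toℕ j)))
      (leadingTerm-resp (+-identityˡ 1#) (leadingTerm-+
        (leadingTerm-sum (λ (j : Fin n) x → x ^ʳ (q ^ toℕ (inject₁ j))) λ j →
          leadingTerm-raise< (ℕₚ.^-monoʳ-< q 1<q (≡.subst (_< n) (≡.sym (toℕ-inject₁ j)) (toℕ<n j)))
            (leadingTerm-^ (q ^ toℕ (inject₁ j))))
        (≡.subst (λ m → LeadingTerm 1# (q ^ n) (_^ʳ (q ^ m))) (≡.sym (toℕ-fromℕ n)) (leadingTerm-^ (q ^ n)))))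
    q^[n-1]<q^n : q ^ (n ∸ 1) < q ^ n
    q^[n-1]<q^n = ℕₚ.^-monoʳ-< q 1<q (ℕₚ.∸-monoʳ-< (s≤s z≤n) 1≤n)
    inject≤′ : Fin (suc (q ^ (n ∸ 1))) → Fin (q ^ n)
    inject≤′ i = inject≤ i q^[n-1]<q^n

  -- Used in two ways: to pass from equal traces against every `vᵢ` to equal traces against their
  -- whole span, and to test a linear relation among the `vᵢ` by pairing it with some `y`.
  Tr-combination : ∀ {m} c (b : Vector Carrier m) y →
    Tr (combination c b * y) ≈ sum λ i → ι (c i) * Tr (b i * y)
  Tr-combination {zero}  c b y = trans (Tr-cong (zeroˡ y)) Tr-0
  Tr-combination {suc m} c b y = begin
    Tr ((ι (c zero) * b zero + C) * y)              ≈⟨ Tr-cong (distribʳ y _ _) ⟩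
    Tr (ι (c zero) * b zero * y + C * y)            ≈⟨ Tr-homo-+ _ _ ⟩
    Tr (ι (c zero) * b zero * y) + Tr (C * y)
      ≈⟨ +-cong (trans (Tr-cong (*-assoc _ _ _)) (Tr-homo-* (c zero) (b zero * y))) (Tr-combination (c ∘ suc) (b ∘ suc) y) ⟩
    ι (c zero) * Tr (b zero * y) + sum (λ i → ι (c (suc i)) * Tr (b (suc i) * y)) ∎
    where C = combination (c ∘ suc) (b ∘ suc)

  -- Trace coordinates and linear combinations over `K`.

  tr : Carrier → K.Carrier
  tr x = proj₁ (fixed⇒∈K (Tr x) (Tr-^q x))

  ι-tr : ∀ x → ι (tr x) ≈ Tr x
  ι-tr x = proj₂ (fixed⇒∈K (Tr x) (Tr-^q x))

  -- `tr x` is found by a search through `K`; that it respects equality is inherited from `Tr`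
  -- through the injectivity of `ι`.
  tr-cong : ∀ {x y} → x ≈ y → tr x K.≈ tr y
  tr-cong x≈y = injective (trans (ι-tr _) (trans (Tr-cong x≈y) (sym (ι-tr _))))

  traces : Vector Carrier n → Carrier → Vector K.Carrier n
  traces v y i = tr (v i * y)

  traces-cong : ∀ v → Congruent _≈_ V._≋_ (traces v)
  traces-cong v y≈z i = tr-cong (*-congˡ y≈z)

  combination-congˡ : ∀ {m} (b : Vector Carrier m) {c d} → c V.≋ d → combination c b ≈ combination d b
  combination-congˡ b c≋d = sum-cong-≋ λ i → *-congʳ (ι-cong (c≋d i))

  combination-minus : ∀ {m} c d (b : Vector Carrier m) →
    combination (λ i → c i K.- d i) b + combination d b ≈ combination c b
  combination-minus c d b = trans
    (sym (∑-distrib-+ (λ i → ι (c i K.- d i) * b i) (λ i → ι (d i) * b i)))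
    (sum-cong-≋ λ i → begin
      ι (c i K.- d i) * b i + ι (d i) * b i ≈⟨ distribʳ (b i) _ _ ⟨
      (ι (c i K.- d i) + ι (d i)) * b i     ≈⟨ *-congʳ (+-homo (c i K.- d i) (d i)) ⟨
      ι ((c i K.- d i) K.+ d i) * b i       ≈⟨ *-congʳ (ι-cong (K.trans (K.+-assoc _ _ _) (K.trans (K.+-congˡ (K.-‿inverseˡ (d i))) (K.+-identityʳ (c i))))) ⟩
      ι (c i) * b i                         ∎)

  combination-0 : ∀ {m} (b : Vector Carrier m) → combination (λ _ → K.0#) b ≈ 0#
  combination-0 {m} b = trans (sum-cong-≋ λ i → trans (*-congʳ 0#-homo) (zeroˡ (b i))) (sum-replicate-zero m)

  CombinationInjective CombinationSurjective : Vector Carrier n → Set _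
  CombinationInjective  b = Injective V._≋_ _≈_ λ c → combination c b
  CombinationSurjective b = Surjective V._≋_ _≈_ λ c → combination c b

  private
    K^n-enumeration : Inverse (V.≋-setoid n) (≡.setoid (Fin (q ^ n)))
    K^n-enumeration = vectorEnumeration K.setoid K.enumeration n

  independent⇒injective : ∀ {b : Vector Carrier n} →
    (∀ c → combination c b ≈ 0# → ∀ i → c i K.≈ K.0#) → CombinationInjective b
  independent⇒injective {b} independent {c} {d} eq i =
    K.+-cancelʳ (K.- d i) (c i) (d i) (K.trans
      (independent (λ i → c i K.- d i)
        (+-cancelʳ (combination d b) _ 0#
          (trans (combination-minus c d b) (trans eq (sym (+-identityˡ _))))) i)
      (K.sym (K.-‿inverseʳ (d i))))

  -- Spanning comes from `q ^ n` coefficient vectors having `q ^ n` distinct combinations in `L`.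
  injective⇒basis : ∀ {b : Vector Carrier n} → CombinationInjective b → IsBasis b
  injective⇒basis {b} inj = record
    { independent = λ c eq → inj (trans eq (sym (combination-0 b)))
    ; spanning    = λ x → let c , c↦x = surj x in c , c↦x V.≋-refl
    }
    where surj = equinumerous-injective⇒surjective K^n-enumeration enumeration (combination-congˡ b) inj

  surjective⇒injective : ∀ {b : Vector Carrier n} → CombinationSurjective b → CombinationInjective b
  surjective⇒injective {b} = equinumerous-surjective⇒injective K^n-enumeration enumeration (combination-congˡ b)

  -- If Tr (vᵢ y) = Tr (vᵢ z) for all i then Tr (w y) = Tr (w z) for all w, and
  -- were y ≠ z, then w = u / (y - z) with Tr u ≠ 0 would contradict this.
  spanning⇒traces-injective : ∀ {v} → IsBasis v → Injective _≈_ V._≋_ (traces v)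
  spanning⇒traces-injective {v} v-basis {y} {z} eq = decidable-stable (y ≟ z) λ y≉z →
    let u , Tru≉0 = ∃Tr≉0
        d⁻¹ , d⁻¹d≈1 , _ = invertible (y - z) (x≉y⇒x-y≉0 y≉z)
        w = u * d⁻¹
        wy≈u+wz : w * y ≈ u + w * z
        wy≈u+wz = begin
          w * y                  ≈⟨ *-congˡ (trans (+-assoc y (- z) z) (trans (+-congˡ (-‿inverseˡ z)) (+-identityʳ y))) ⟨
          w * ((y - z) + z)      ≈⟨ solve 4 (λ u e d z → (u :* e) :* (d :+ z) := u :* (e :* d) :+ (u :* e) :* z) refl u d⁻¹ (y - z) z ⟩
          u * (d⁻¹ * (y - z)) + w * z ≈⟨ +-congʳ (trans (*-congˡ d⁻¹d≈1) (*-identityʳ u)) ⟩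
          u + w * z              ∎
    in Tru≉0 (+-cancelʳ (Tr (w * z)) (Tr u) 0# (begin
      Tr u + Tr (w * z)  ≈⟨ Tr-homo-+ u (w * z) ⟨
      Tr (u + w * z)     ≈⟨ Tr-cong wy≈u+wz ⟨
      Tr (w * y)         ≈⟨ Tr[wy]≈Tr[wz] w ⟩
      Tr (w * z)         ≈⟨ +-identityˡ _ ⟨
      0# + Tr (w * z)    ∎))
    where
    open IsBasis v-basis
    Tr[wy]≈Tr[wz] : ∀ w → Tr (w * y) ≈ Tr (w * z)
    Tr[wy]≈Tr[wz] w with c , cv≈w ← spanning w = begin
      Tr (w * y)                           ≈⟨ Tr-cong (*-congʳ cv≈w) ⟨
      Tr (combination c v * y)             ≈⟨ Tr-combination c v y ⟩
      sum (λ i → ι (c i) * Tr (v i * y))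
        ≈⟨ sum-cong-≋ (λ i → *-congˡ (trans (sym (ι-tr _)) (trans (ι-cong (eq i)) (ι-tr _)))) ⟩
      sum (λ i → ι (c i) * Tr (v i * z))   ≈⟨ Tr-combination c v z ⟨
      Tr (combination c v * z)             ≈⟨ Tr-cong (*-congʳ cv≈w) ⟩
      Tr (w * z)                           ∎

  -- Pairing Σ cᵢ vᵢ = 0 with y such that Tr (vᵢ y) = δᵢⱼ gives cⱼ = 0.
  traces-surjective⇒independent : ∀ {v} → Surjective _≈_ V._≋_ (traces v) →
    ∀ c → combination c v ≈ 0# → ∀ i → c i K.≈ K.0#
  traces-surjective⇒independent {v} surj c cv≈0 j = injective (begin
    ι (c j)                              ≈⟨ *-identityʳ _ ⟨
    ι (c j) * 1#                         ≈⟨ *-congˡ (trans (Tr≈ιδ j) (trans (ι-cong (reflexiveᴷ δⱼⱼ)) 1#-homo)) ⟨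
    ι (c j) * Tr (v j * y)
      ≈⟨ sum-single +-commutativeMonoid (λ i → ι (c i) * Tr (v i * y)) j
           (λ i i≢j → trans (*-congˡ (trans (Tr≈ιδ i) (trans (ι-cong (reflexiveᴷ (δᵢⱼ i≢j))) 0#-homo))) (zeroʳ _)) ⟨
    sum (λ i → ι (c i) * Tr (v i * y))   ≈⟨ Tr-combination c v y ⟨
    Tr (combination c v * y)             ≈⟨ Tr-cong (trans (*-congʳ cv≈0) (zeroˡ y)) ⟩
    Tr 0#                                ≈⟨ Tr-0 ⟩
    0#                                   ≈⟨ 0#-homo ⟨
    ι K.0#                               ∎)
    where
    reflexiveᴷ = K.reflexive
    δ : Vector K.Carrier n
    δ = updateAt (replicate n K.0#) j (λ _ → K.1#)
    δⱼⱼ : δ j ≡ K.1#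
    δⱼⱼ = updateAt-updates j (replicate n K.0#)
    δᵢⱼ : ∀ {i} → i ≢ j → δ i ≡ K.0#
    δᵢⱼ {i} i≢j = updateAt-minimal i j (replicate n K.0#) i≢j
    y : Carrier
    y = proj₁ (surj δ)
    Tr≈ιδ : ∀ i → Tr (v i * y) ≈ ι (δ i)
    Tr≈ιδ i = trans (sym (ι-tr _)) (ι-cong (proj₂ (surj δ) refl i))

  -- From formal polynomials to the maps that they induce.

  evaluate-tracePoly : ∀ x → evaluate (tracePoly q n) x ≈ Tr x
  evaluate-tracePoly x = trans (evaluate-sumₚ {n} (λ j → X ^ₚ (q ^ toℕ j)) x)
    (sum-cong-≋ λ (j : Fin n) → trans (evaluate-^ₚ X (q ^ toℕ j) x) (^-congˡ (q ^ toℕ j) (evaluate-X x)))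

  evaluate-map-ι : ∀ h κ → evaluate (List.map ι h) (ι κ) ≈ ι (K.evaluate h κ)
  evaluate-map-ι []      κ = sym 0#-homo
  evaluate-map-ι (a ∷ h) κ = begin
    ι a + ι κ * evaluate (List.map ι h) (ι κ) ≈⟨ +-congˡ (*-congˡ (evaluate-map-ι h κ)) ⟩
    ι a + ι κ * ι (K.evaluate h κ)            ≈⟨ +-congˡ (*-homo κ _) ⟨
    ι a + ι (κ K.* K.evaluate h κ)            ≈⟨ +-homo a _ ⟨
    ι (a K.+ κ K.* K.evaluate h κ)            ∎

  evaluateAll : Vector K.Poly n → Vector K.Carrier n → Vector K.Carrier n
  evaluateAll h c i = K.evaluate (h i) (c i)

  evaluate-traceSum : ∀ f h a v x →
    evaluate (traceSum q f h a v) x ≈ combination (evaluateAll h (traces v (evaluate f x))) a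
  evaluate-traceSum f h a v x = trans (evaluate-sumₚ (λ i → const (a i) *ₚ (hι i ∘ₚ Trvf i)) x) (sum-cong-≋ λ i → begin
    evaluate (const (a i) *ₚ (hι i ∘ₚ Trvf i)) x
      ≈⟨ trans (evaluate-*ₚ (const (a i)) (hι i ∘ₚ Trvf i) x) (*-congʳ (evaluate-const (a i) x)) ⟩
    a i * evaluate (hι i ∘ₚ Trvf i) x
      ≈⟨ *-congˡ (evaluate-∘ₚ (hι i) (Trvf i) x) ⟩
    a i * evaluate (hι i) (evaluate (Trvf i) x)
      ≈⟨ *-congˡ (evaluate-cong (hι i) (evaluate-Trvf i)) ⟩
    a i * evaluate (hι i) (ι (traces v (evaluate f x) i))
      ≈⟨ *-congˡ (evaluate-map-ι (h i) (traces v (evaluate f x) i)) ⟩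
    a i * ι (evaluateAll h (traces v (evaluate f x)) i)
      ≈⟨ *-comm _ _ ⟩
    ι (evaluateAll h (traces v (evaluate f x)) i) * a i ∎)
    where
    hι vf Trvf : Vector Poly n
    hι   i = List.map ι (h i)
    vf   i = const (v i) *ₚ f
    Trvf i = tracePoly q n ∘ₚ vf i
    evaluate-Trvf : ∀ i → evaluate (Trvf i) x ≈ ι (traces v (evaluate f x) i)
    evaluate-Trvf i = begin
      evaluate (Trvf i) x                      ≈⟨ evaluate-∘ₚ (tracePoly q n) (vf i) x ⟩
      evaluate (tracePoly q n) (evaluate (vf i) x) ≈⟨ evaluate-tracePoly (evaluate (vf i) x) ⟩
      Tr (evaluate (vf i) x)
        ≈⟨ Tr-cong (trans (evaluate-*ₚ (const (v i)) f x) (*-congʳ (evaluate-const (v i) x))) ⟩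
      Tr (v i * evaluate f x)                  ≈⟨ ι-tr (v i * evaluate f x) ⟨
      ι (traces v (evaluate f x) i)            ∎

  -- The two directions of the equivalence.

  module _ (f : Poly) (f-permutation : IsPermutationPolynomial f)
    (h : Vector K.Poly n) (a v : Vector Carrier n) where

    private
      F : Poly
      F = traceSum q f h a v

      f-injective = proj₁ f-permutation
      f-surjective = proj₂ f-permutation

      G : Carrier → Carrier
      G y = combination (evaluateAll h (traces v y)) a

      G-cong : ∀ {y z} → traces v y V.≋ traces v z → G y ≈ G z
      G-cong eq = combination-congˡ a λ i → K.evaluate-cong (h i) (eq i)

      F≈G∘f : ∀ x → evaluate F x ≈ G (evaluate f x)
      F≈G∘f = evaluate-traceSum f h a v

    -- Surjectivity of `F` is inherited by the combination map of `a`, injectivity by `traces v`;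
    -- counting turns the first into injectivity and the second into surjectivity, and independence
    -- follows from each.
    permutation⇒bases : IsPermutationPolynomial F → (IsBasis a × IsBasis v) × (∀ i → K.IsPermutationPolynomial (h i))
    permutation⇒bases (F-injective , F-surjective) =
      (injective⇒basis a-injective , injective⇒basis (independent⇒injective v-independent)) , λ i →
        equinumerous-surjective⇒injective K.enumeration K.enumeration (K.evaluate-cong (h i)) (h-surjective i) ,
        h-surjective i
      where
      G-surjective : ∀ x → ∃ λ y → G y ≈ x
      G-surjective x with x′ , x′↦x ← F-surjective x =
        evaluate f x′ , trans (sym (F≈G∘f x′)) (x′↦x refl)

      a-injective : CombinationInjective a
      a-injective = surjective⇒injective λ x → let y , Gy≈x = G-surjective x in
        evaluateAll h (traces v y) , λ c≋ → trans (combination-congˡ a c≋) Gy≈x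

      h-surjective : ∀ i → Surjective K._≈_ K._≈_ (K.evaluate (h i))
      -- Aim at the image of a vector with `i`-th coordinate `κ`, here a constant one. As
      -- combinations of `a` are injective, any `y` reaching it satisfies `hᵢ (tr (vᵢ y)) = κ`.
      h-surjective i κ with y , Gy≈ ← G-surjective (combination (λ _ → κ) a) =
        traces v y i , λ eq → K.trans (K.evaluate-cong (h i) eq) (a-injective Gy≈ i)

      traces-injective : Injective _≈_ V._≋_ (traces v)
      -- Injectivity of `F` speaks of arguments of `f`, so `y` and `z` are first pulled back along
      -- the surjective `f`.
      traces-injective {y} {z} eq
        with y′ , y′↦y ← f-surjective y | z′ , z′↦z ← f-surjective z = begin
        y             ≈⟨ y′↦y refl ⟨
        evaluate f y′ ≈⟨ evaluate-cong f (F-injective (begin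
          evaluate F y′    ≈⟨ F≈G∘f y′ ⟩
          G (evaluate f y′) ≈⟨ G-cong (traces-cong v (y′↦y refl)) ⟩
          G y              ≈⟨ G-cong eq ⟩
          G z              ≈⟨ G-cong (traces-cong v (z′↦z refl)) ⟨
          G (evaluate f z′) ≈⟨ F≈G∘f z′ ⟨
          evaluate F z′    ∎)) ⟩
        evaluate f z′ ≈⟨ z′↦z refl ⟩
        z             ∎

      v-independent : ∀ c → combination c v ≈ 0# → ∀ i → c i K.≈ K.0#
      v-independent = traces-surjective⇒independent
        (equinumerous-injective⇒surjective enumeration K^n-enumeration (traces-cong v) traces-injective)

    -- Injectivity is peeled off one factor at a time, from the combination map of `a` inwards to
    -- `f`; surjectivity then follows because `F` induces a self-map of the finite `L`.
    bases⇒permutation : (IsBasis a × IsBasis v) × (∀ i → K.IsPermutationPolynomial (h i)) → IsPermutationPolynomial F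
    bases⇒permutation ((a-basis , v-basis) , h-permutation) =
      F-injective , equinumerous-injective⇒surjective enumeration enumeration (evaluate-cong F) F-injective
      where
      F-injective : Injective _≈_ _≈_ (evaluate F)
      F-injective {x} {y} Fx≈Fy = f-injective (spanning⇒traces-injective v-basis λ i →
        proj₁ (h-permutation i) (independent⇒injective (IsBasis.independent a-basis)
          (trans (sym (F≈G∘f x)) (trans Fx≈Fy (F≈G∘f y))) i))

theorem2p1 : ∀ {c₁ ℓ₁ c₂ ℓ₂ : Level} (q n : ℕ) → IsPrimePower q → 1 ≤ n →
    (K : CommutativeRing c₁ ℓ₁) (L : CommutativeRing c₂ ℓ₂) →
    IsFieldOfOrder K q → IsFieldOfOrder L (q ^ n) →
    (ι : CommutativeRing.Carrier K → CommutativeRing.Carrier L) →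
    Extension.IsEmbedding K L ι →
    (f : Polynomial.Poly L) → Polynomial.IsPermutationPolynomial L f →
    (h : Vector (Polynomial.Poly K) n) →
    (a v : Vector (CommutativeRing.Carrier L) n) →
    Polynomial.IsPermutationPolynomial L (Extension.traceSum K L ι q f h a v)
      ⇔ ((Extension.IsBasis K L ι a × Extension.IsBasis K L ι v)
          × (∀ i → Polynomial.IsPermutationPolynomial K (h i)))
theorem2p1 q n q-primePower 1≤n K L K-isField L-isField ι ι-isEmbedding f f-permutation h a v =
  mk⇔ (permutation⇒bases f f-permutation h a v) (bases⇒permutation f f-permutation h a v)
  where open Trace q-primePower 1≤n K L K-isField L-isField ι ι-isEmbedding
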